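{- For every prime $p\neq 3$, one has $\nu(p)=\nu(2p)=1$.
   Context: Let $F(x,y,z)=x^3+y^3+z^3-3xyz$. For a positive integer $n$, $\nu(n)$ denotes the number of triples of integers $(x,y,z)$ with $0\leq x\leq y\leq z$ and $z\geq x+1$ such that $F(x,y,z)=n$. -}

module Defs where

open import Data.Integer using (ℤ; +_; _+_; _-_; _*_; _^_; _≤_; _≥_; 0ℤ; 1ℤ; +≤+)
open import Data.Integer.Properties
  using (_≟_; _≤?_; +-injective; pos-*)
open import Data.Integer.Solver using (module +-*-Solver)
open import Data.List using (List; length; filter; map; upTo; cartesianProduct)
open import Data.List.Membership.Propositional using (_∈_)
open import Data.List.Membership.Propositional.Properties
  using (∈-filter⁺; ∈-filter⁻; ∈-cartesianProduct⁺; ∈-map⁺; ∈-upTo⁺)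
open import Data.List.Relation.Unary.Unique.Propositional using (Unique)
import Data.List.Relation.Unary.Unique.Propositional.Properties as Unique
open import Data.Nat as ℕ using (ℕ; zero; suc; z≤n; s≤s)
import Data.Nat.Properties as ℕ
open import Data.Product using (_×_; _,_; proj₂)
open import Function using (_⇔_; mk⇔)
open import Relation.Binary.PropositionalEquality
  using (_≡_; refl; sym; trans; cong; cong₂; subst)
open import Relation.Nullary using (Dec; contradiction)
open import Relation.Nullary.Decidable using (_×-dec_)

F : ℤ → ℤ → ℤ → ℤ
F x y z = x ^ 3 + y ^ 3 + z ^ 3 - + 3 * x * y * z

IsSolution : ℕ → ℤ × ℤ × ℤ → Set
IsSolution n (x , y , z) =
  0ℤ ≤ x × x ≤ y × y ≤ z × z ≥ x + 1ℤ × F x y z ≡ + n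

isSolution? : ∀ n t → Dec (IsSolution n t)
isSolution? n (x , y , z) =
  0ℤ ≤? x ×-dec x ≤? y ×-dec y ≤? z ×-dec x + 1ℤ ≤? z ×-dec F x y z ≟ + n

-- Every solution lies in the cube [0, n]³ (see ∈-solutions), so the
-- search below is exhaustive.
range : ℕ → List ℤ
range n = map +_ (upTo (suc n))

solutions : ℕ → List (ℤ × ℤ × ℤ)
solutions n = filter (isSolution? n)
  (cartesianProduct (range n) (cartesianProduct (range n) (range n)))

-- The number of solutions: by solutions-unique and ∈-solutions, the list
-- contains every solution exactly once and nothing else.
ν : ℕ → ℕ
ν n = length (solutions n)

solutions-unique : ∀ n → Unique (solutions n)
solutions-unique n = Unique.filter⁺ (isSolution? n)
  (Unique.cartesianProduct⁺ range! (Unique.cartesianProduct⁺ range! range!))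
  where
  range! : Unique (range n)
  range! = Unique.map⁺ +-injective (Unique.upTo⁺ (suc n))

private
  -- x + y + z and x² + y² + z² - xy - yz - zx, whose product is F x y z,
  -- at x = a, y = a + b, z = a + b + c.
  L : ℕ → ℕ → ℕ → ℕ
  L a b c = (a ℕ.+ b ℕ.+ c) ℕ.+ (a ℕ.+ (a ℕ.+ b))

  Q : ℕ → ℕ → ℕ
  Q b c = b ℕ.* b ℕ.+ (b ℕ.* c ℕ.+ c ℕ.* c)

  F-factorℤ : ∀ x u v →
    F x (x + u) (x + u + v) ≡
    ((x + u + v) + (x + (x + u))) * (u * u + (u * v + v * v))
  F-factorℤ = solve 3 (λ x u v →
      x :^ 3 :+ (x :+ u) :^ 3 :+ (x :+ u :+ v) :^ 3
        :- con (+ 3) :* x :* (x :+ u) :* (x :+ u :+ v)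
      := ((x :+ u :+ v) :+ (x :+ (x :+ u))) :* (u :* u :+ (u :* v :+ v :* v)))
    refl
    where open +-*-Solver

  F-factor : ∀ a b c →
    F (+ a) (+ (a ℕ.+ b)) (+ (a ℕ.+ b ℕ.+ c)) ≡ + (L a b c ℕ.* Q b c)
  F-factor a b c = trans (F-factorℤ (+ a) (+ b) (+ c))
    (trans (cong (+ L a b c *_) posQ) (sym (pos-* (L a b c) (Q b c))))
    where
    posQ : + b * + b + (+ b * + c + + c * + c) ≡ + Q b c
    posQ = sym (cong₂ _+_ (pos-* b b) (cong₂ _+_ (pos-* b c) (pos-* c c)))

  1≤Q : ∀ a b c → a ℕ.+ 1 ℕ.≤ a ℕ.+ b ℕ.+ c → 1 ℕ.≤ Q b c
  1≤Q a zero zero h = contradiction (subst (a ℕ.+ 1 ℕ.≤_) a+0+0≡a h) (ℕ.m+1+n≰m a)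
    where
    a+0+0≡a : a ℕ.+ 0 ℕ.+ 0 ≡ a
    a+0+0≡a = trans (ℕ.+-identityʳ _) (ℕ.+-identityʳ a)
  1≤Q a zero (suc c) h = s≤s z≤n
  1≤Q a (suc b) c h = s≤s z≤n

  z-bound : ∀ {n} i j k → i ℕ.≤ j → j ℕ.≤ k → i ℕ.+ 1 ℕ.≤ k →
            F (+ i) (+ j) (+ k) ≡ + n → k ℕ.≤ n
  z-bound {n} i j k i≤j j≤k i<k eq
    with b , refl ← ℕ.m≤n⇒∃[o]m+o≡n i≤j
    with c , refl ← ℕ.m≤n⇒∃[o]m+o≡n j≤k = begin
      i ℕ.+ b ℕ.+ c       ≤⟨ ℕ.m≤m+n _ _ ⟩
      L i b c             ≡⟨ ℕ.*-identityʳ _ ⟨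
      L i b c ℕ.* 1       ≤⟨ ℕ.*-monoʳ-≤ (L i b c) (1≤Q i b c i<k) ⟩
      L i b c ℕ.* Q b c   ≡⟨ +-injective (trans (sym (F-factor i b c)) eq) ⟩
      n                   ∎
    where open ℕ.≤-Reasoning

∈-solutions : ∀ n t → t ∈ solutions n ⇔ IsSolution n t
∈-solutions n t = mk⇔ (λ t∈ → proj₂ (∈-filter⁻ (isSolution? n) {xs = cube} t∈)) (complete t)
  where
  cube : List (ℤ × ℤ × ℤ)
  cube = cartesianProduct (range n) (cartesianProduct (range n) (range n))

  ∈-range : ∀ {i} → i ℕ.≤ n → + i ∈ range n
  ∈-range i≤n = ∈-map⁺ +_ (∈-upTo⁺ (s≤s i≤n))

  complete : ∀ t → IsSolution n t → t ∈ solutions n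
  complete (+ i , + j , + k) s@(_ , +≤+ i≤j , +≤+ j≤k , +≤+ i<k , eq) =
    ∈-filter⁺ (isSolution? n)
      (∈-cartesianProduct⁺ (∈-range (ℕ.≤-trans i≤j j≤n))
        (∈-cartesianProduct⁺ (∈-range j≤n) (∈-range k≤n))) s
    where
    k≤n : k ℕ.≤ n
    k≤n = z-bound i j k i≤j j≤k i<k eq
    j≤n : j ℕ.≤ n
    j≤n = ℕ.≤-trans j≤k k≤n

{-# OPTIONS --safe #-}
-- At (x, y, z) = (a, a + b, a + b + c) the form F factors as L · Q with
-- L = 3a + 2b + c and Q = b² + bc + c².  If L · Q = m p with p prime and
-- m ≤ 2, then p divides L, so that Q ≤ 2, or p divides Q, so that L ≤ 2;
-- either way {b, c} = {0, 1}, apart from L = 2, Q = 4, where p would be 4.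
-- With {b, c} = {0, 1} the value is 3a + 1 or 3a + 2, and a number prime to 3
-- is of exactly one of these forms, for exactly one a.
module Submission where

open import Defs
open import Data.Fin.Patterns using (0F; 1F; 2F)
open import Data.Integer as ℤ using (ℤ; +_; +≤+)
import Data.Integer.Properties as ℤ
open import Data.Integer.Solver using (module +-*-Solver)
open import Data.List using ([]; _∷_; length)
open import Data.List.Membership.Propositional using (_∈_)
open import Data.List.Relation.Unary.All using (_∷_)
open import Data.List.Relation.Unary.AllPairs using (_∷_)
open import Data.List.Relation.Unary.Any using (here; there)
open import Data.List.Relation.Unary.Unique.Propositional using (Unique)
open import Data.Nat using (ℕ; zero; suc; _+_; _*_; _≤_; _<_; z≤n; s≤s; NonZero; ≢-nonZero⁻¹)
open import Data.Nat.Divisibility using (_∤_; divides; ∣⇒≤; >⇒∤)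
open import Data.Nat.DivMod using (_divMod_; result)
open import Data.Nat.Primality
  using (Prime; prime?; euclidsLemma; prime⇒irreducible; prime⇒nonZero)
open import Data.Nat.Properties
open import Data.Product using (_×_; _,_; ∃)
open import Data.Sum using (_⊎_; inj₁; inj₂)
open import Function using (Equivalence; case_of_)
open import Relation.Binary.PropositionalEquality
  using (_≡_; _≢_; refl; sym; trans; cong; cong₂; subst)
open import Relation.Nullary using (contradiction)
open import Relation.Nullary.Decidable using (from-yes; from-no)

length≡1 : ∀ {A : Set} {x : A} {xs} → Unique xs → x ∈ xs →
           (∀ {y} → y ∈ xs → y ≡ x) → length xs ≡ 1
length≡1 {xs = _ ∷ []} _ _ _ = refl
length≡1 {xs = _ ∷ _ ∷ _} ((y≢z ∷ _) ∷ _) _ all≡x =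
  contradiction (trans (all≡x (here refl)) (sym (all≡x (there (here refl))))) y≢z

ν≡1 : ∀ {n t} → IsSolution n t → (∀ {s} → IsSolution n s → s ≡ t) → ν n ≡ 1
ν≡1 {n} sol unique = length≡1 (solutions-unique n)
  (Equivalence.from (∈-solutions n _) sol)
  (λ s∈ → unique (Equivalence.to (∈-solutions n _) s∈))

triple : ℕ → ℕ → ℕ → ℤ × ℤ × ℤ
triple a b c = + a , + (a + b) , + (a + b + c)

-- The coefficients stand on the right so that a successor in `a` or `b` reduces to three or two
-- visible successors; bounds by 2 are then refuted by matching alone.
L : ℕ → ℕ → ℕ → ℕ
L a b c = a * 3 + (b * 2 + c)

Q : ℕ → ℕ → ℕ
Q b c = b * b + (b * c + c * c)

F-factor : ∀ a b c → F (+ a) (+ (a + b)) (+ (a + b + c)) ≡ + (L a b c * Q b c)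
-- `+ a ℤ.+ + b` computes to `+ (a + b)`, so the integer identity applies directly; only products
-- need transport by `pos-*`.
F-factor a b c = trans (factorℤ (+ a) (+ b) (+ c))
  (trans (cong₂ ℤ._*_ posL posQ) (sym (ℤ.pos-* (L a b c) (Q b c))))
  where
  factorℤ : ∀ x u v →
    F x (x ℤ.+ u) (x ℤ.+ u ℤ.+ v) ≡
    (x ℤ.* + 3 ℤ.+ (u ℤ.* + 2 ℤ.+ v)) ℤ.* (u ℤ.* u ℤ.+ (u ℤ.* v ℤ.+ v ℤ.* v))
  factorℤ = solve 3 (λ x u v →
      x :^ 3 :+ (x :+ u) :^ 3 :+ (x :+ u :+ v) :^ 3
        :- con (+ 3) :* x :* (x :+ u) :* (x :+ u :+ v)
      := (x :* con (+ 3) :+ (u :* con (+ 2) :+ v)) :* (u :* u :+ (u :* v :+ v :* v)))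
    refl
    where open +-*-Solver

  posL : + a ℤ.* + 3 ℤ.+ (+ b ℤ.* + 2 ℤ.+ + c) ≡ + L a b c
  posL = sym (cong₂ ℤ._+_ (ℤ.pos-* a 3) (cong (ℤ._+ + c) (ℤ.pos-* b 2)))

  posQ : + b ℤ.* + b ℤ.+ (+ b ℤ.* + c ℤ.+ + c ℤ.* + c) ≡ + Q b c
  posQ = sym (cong₂ ℤ._+_ (ℤ.pos-* b b) (cong₂ ℤ._+_ (ℤ.pos-* b c) (ℤ.pos-* c c)))

solution⇒triple : ∀ {n t} → IsSolution n t →
  ∃ λ a → ∃ λ b → ∃ λ c → t ≡ triple a b c × L a b c * Q b c ≡ n
-- The chain 0 ≤ x ≤ y ≤ z rules out negative coordinates; `b` and `c` are the successive
-- differences.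
solution⇒triple {t = + i , + j , + k} (_ , +≤+ i≤j , +≤+ j≤k , _ , eq)
  with b , refl ← m≤n⇒∃[o]m+o≡n i≤j
  with c , refl ← m≤n⇒∃[o]m+o≡n j≤k =
  i , b , c , refl , ℤ.+-injective (trans (sym (F-factor i b c)) eq)

triple⇒solution : ∀ a b c → 1 ≤ b + c → IsSolution (L a b c * Q b c) (triple a b c)
triple⇒solution a b c 1≤b+c =
  +≤+ z≤n , +≤+ (m≤m+n a b) , +≤+ (m≤m+n (a + b) c) ,
  +≤+ (subst (a + 1 ≤_) (sym (+-assoc a b c)) (+-monoʳ-≤ a 1≤b+c)) ,
  F-factor a b c

-- These are the pairs at which `Q` is 1. Matching on a constructor fixes `b` and `c`, so that
-- `Q b c` computes.
data UnitSteps : ℕ → ℕ → Set where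
  step₀₁ : UnitSteps 0 1
  step₁₀ : UnitSteps 1 0

n*n≤2⇒n<2 : ∀ {n} → n * n ≤ 2 → n < 2
n*n≤2⇒n<2 n*n≤2 = ≰⇒> λ 2≤n →
  contradiction (≤-trans (*-mono-≤ 2≤n 2≤n) n*n≤2) λ { (s≤s (s≤s ())) }

-- Both squares are at most `Q b c`, which leaves `b` and `c` below 2; there (0, 0) gives 0 and (1,
-- 1) gives 3.
Q≤2⇒unitSteps : ∀ b c → Q b c ≢ 0 → Q b c ≤ 2 → UnitSteps b c
Q≤2⇒unitSteps b c Q≢0 Q≤2 = go b c
  (n*n≤2⇒n<2 (≤-trans (m≤m+n (b * b) _) Q≤2))
  (n*n≤2⇒n<2 (≤-trans (≤-trans (m≤n+m (c * c) (b * c)) (m≤n+m _ (b * b))) Q≤2))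
  Q≢0 Q≤2
  where
  go : ∀ b c → b < 2 → c < 2 → Q b c ≢ 0 → Q b c ≤ 2 → UnitSteps b c
  go 0 0 _ _ Q≢0 _ = contradiction refl Q≢0
  go 0 1 _ _ _ _ = step₀₁
  go 1 0 _ _ _ _ = step₁₀
  go 1 1 _ _ _ (s≤s (s≤s ()))
  go (suc (suc _)) _ (s≤s (s≤s ()))
  go _ (suc (suc _)) _ (s≤s (s≤s ()))

-- The bound forces a = 0 and 2b + c ≤ 2; the exceptional outcome is b = 0, c = 2.
L≤2⇒unitSteps : ∀ a b c → Q b c ≢ 0 → L a b c ≤ 2 →
                UnitSteps b c ⊎ (L a b c ≡ 2 × Q b c ≡ 4)
L≤2⇒unitSteps 0 0 0 Q≢0 _ = contradiction refl Q≢0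
L≤2⇒unitSteps 0 0 1 _ _ = inj₁ step₀₁
L≤2⇒unitSteps 0 0 2 _ _ = inj₂ (refl , refl)
L≤2⇒unitSteps 0 0 (suc (suc (suc _))) _ (s≤s (s≤s ()))
L≤2⇒unitSteps 0 1 0 _ _ = inj₁ step₁₀
L≤2⇒unitSteps 0 1 (suc _) _ (s≤s (s≤s ()))
L≤2⇒unitSteps 0 (suc (suc _)) _ _ (s≤s (s≤s ()))
L≤2⇒unitSteps (suc _) _ _ _ (s≤s (s≤s ()))

unitSteps : ∀ {p m} a b c → Prime p → .{{NonZero m}} → m ≤ 2 →
            L a b c * Q b c ≡ m * p → UnitSteps b c
unitSteps {p} {m} a b c pp m≤2 eq =
  case euclidsLemma (L a b c) (Q b c) pp (divides m eq) of λ where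
    -- Cancelling `p` leaves Q k = m, so that Q divides `m`.
    (inj₁ (divides k L≡kp)) → Q≤2⇒unitSteps b c Q≢0
      (factor≤2 (Q b c) k (cofactor (Q b c) k (trans (*-comm (Q b c) (L a b c)) eq) L≡kp))
    (inj₂ (divides k Q≡kp)) →
      let Lk≡m = cofactor (L a b c) k eq Q≡kp in
      case L≤2⇒unitSteps a b c Q≢0 (factor≤2 (L a b c) k Lk≡m) of λ where
        (inj₁ steps) → steps
        -- Here 2k = m ≤ 2, so k is 0 or 1, and 4 = k p would read 4 = 0 or 4 = p.
        (inj₂ (L≡2 , Q≡4)) → contradiction
          (trans (sym Q≡4) Q≡kp)
          (4≢kp k (subst (_≤ 2) (trans (sym Lk≡m) (cong (_* k) L≡2)) m≤2))
  where
  instance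
    p≢0 : NonZero p
    p≢0 = prime⇒nonZero pp
    mp≢0 : NonZero (m * p)
    mp≢0 = m*n≢0 m p

  Q≢0 : Q b c ≢ 0
  Q≢0 Q≡0 = ≢-nonZero⁻¹ (m * p)
    (trans (sym eq) (trans (cong (L a b c *_) Q≡0) (*-zeroʳ (L a b c))))

  cofactor : ∀ {q} l k → l * q ≡ m * p → q ≡ k * p → l * k ≡ m
  cofactor l k lq≡mp q≡kp = *-cancelʳ-≡ (l * k) m p
    (trans (*-assoc l k p) (trans (cong (l *_) (sym q≡kp)) lq≡mp))

  factor≤2 : ∀ l k → l * k ≡ m → l ≤ 2
  factor≤2 l k lk≡m = ≤-trans (∣⇒≤ (divides k (trans (sym lk≡m) (*-comm l k)))) m≤2

  4≢kp : ∀ k → 2 * k ≤ 2 → 4 ≢ k * p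
  4≢kp zero _ ()
  4≢kp 1 _ 4≡p = from-no (prime? 4) (subst Prime (sym (trans 4≡p (*-identityˡ p))) pp)
  4≢kp (suc (suc k)) 2k≤2 _ =
    contradiction (≤-trans (*-monoʳ-≤ 2 (s≤s (s≤s z≤n))) 2k≤2) λ { (s≤s (s≤s ())) }

-- The right side has the shape in which `divMod` states a division by 3, with b * 2 + c, which is 1
-- or 2, as the remainder.
unitSteps-value : ∀ {b c} a → UnitSteps b c → L a b c * Q b c ≡ (b * 2 + c) + a * 3
unitSteps-value a step₀₁ = trans (*-identityʳ _) (+-comm (a * 3) 1)
unitSteps-value a step₁₀ = trans (*-identityʳ _) (+-comm (a * 3) 2)

unitSteps⇒solution : ∀ {n b c} a → UnitSteps b c → n ≡ (b * 2 + c) + a * 3 →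
                     IsSolution n (triple a b c)
unitSteps⇒solution {b = b} {c} a steps n≡ =
  subst (λ n → IsSolution n (triple a b c)) (trans (unitSteps-value a steps) (sym n≡))
    (triple⇒solution a b c (1≤ steps))
  where
  1≤ : ∀ {b c} → UnitSteps b c → 1 ≤ b + c
  1≤ step₀₁ = s≤s z≤n
  1≤ step₁₀ = s≤s z≤n

m*3≢1+n*3 : ∀ m n → m * 3 ≢ 1 + n * 3
m*3≢1+n*3 (suc m) (suc n) eq = m*3≢1+n*3 m n (+-cancelˡ-≡ 3 _ _ eq)

unitSteps-injective : ∀ {b c b′ c′} a a′ → UnitSteps b c → UnitSteps b′ c′ →
  (b * 2 + c) + a * 3 ≡ (b′ * 2 + c′) + a′ * 3 → triple a b c ≡ triple a′ b′ c′
unitSteps-injective a a′ step₀₁ step₀₁ eq =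
  cong (λ a → triple a 0 1) (*-cancelʳ-≡ a a′ 3 (+-cancelˡ-≡ 1 _ _ eq))
unitSteps-injective a a′ step₁₀ step₁₀ eq =
  cong (λ a → triple a 1 0) (*-cancelʳ-≡ a a′ 3 (+-cancelˡ-≡ 2 _ _ eq))
-- Unequal kinds of step give residues 1 and 2 modulo 3; cancelling 1 makes a multiple of 3 equal to
-- one more than another.
unitSteps-injective a a′ step₀₁ step₁₀ eq =
  contradiction (+-cancelˡ-≡ 1 _ _ eq) (m*3≢1+n*3 a a′)
unitSteps-injective a a′ step₁₀ step₀₁ eq =
  contradiction (sym (+-cancelˡ-≡ 1 _ _ eq)) (m*3≢1+n*3 a′ a)

3∤⇒unitSteps : ∀ {n} → 3 ∤ n →
  ∃ λ a → ∃ λ b → ∃ λ c → UnitSteps b c × n ≡ (b * 2 + c) + a * 3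
3∤⇒unitSteps {n} 3∤n with n divMod 3
... | result a 0F n≡ = contradiction (divides a n≡) 3∤n
... | result a 1F n≡ = a , 0 , 1 , step₀₁ , n≡
... | result a 2F n≡ = a , 1 , 0 , step₁₀ , n≡

-- Division of m p by 3 supplies a solution. Any other one also has unit steps and the same value,
-- hence is the same triple.
ν[m*p]≡1 : ∀ {p} m → .{{NonZero m}} → m ≤ 2 → Prime p → p ≢ 3 → ν (m * p) ≡ 1
ν[m*p]≡1 {p} m m≤2 pp p≢3 =
  let a , b , c , steps , mp≡ = 3∤⇒unitSteps 3∤mp in
  ν≡1 (unitSteps⇒solution a steps mp≡) λ sol →
    let a′ , b′ , c′ , s≡ , eq = solution⇒triple sol
        steps′ = unitSteps a′ b′ c′ pp m≤2 eq
    in trans s≡ (unitSteps-injective a′ a steps′ steps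
         (trans (sym (unitSteps-value a′ steps′)) (trans eq mp≡)))
  where
  3∤p : 3 ∤ p
  -- A divisor of `p` is 1 or `p`; the case 3 = 1 is absurd by its constructors.
  3∤p 3∣p with prime⇒irreducible pp 3∣p
  ... | inj₂ 3≡p = p≢3 (sym 3≡p)

  3∤mp : 3 ∤ m * p
  3∤mp 3∣mp with euclidsLemma m p (from-yes (prime? 3)) 3∣mp
  ... | inj₁ 3∣m = >⇒∤ (s≤s m≤2) 3∣m
  ... | inj₂ 3∣p = 3∤p 3∣p

proposition4 : ∀ (p : ℕ) → Prime p → p ≢ 3 → ν p ≡ 1 × ν (2 * p) ≡ 1
proposition4 p pp p≢3 =
  subst (λ n → ν n ≡ 1) (*-identityˡ p) (ν[m*p]≡1 1 (s≤s z≤n) pp p≢3) ,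
  ν[m*p]≡1 2 ≤-refl pp p≢3
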